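{- Let $k\geq 2$ be an integer. For any graph $G$ with minimum degree $\delta(G)\geq k-1$, \[ \gamma_{\times k}(G)+k\leq \gamma_{\times kR}(G)\leq 2\gamma_{\times k}(G), \] and the lower bound is sharp (that is, there exists a graph $G$ with $\delta(G)\geq k-1$ and $\gamma_{\times kR}(G)=\gamma_{\times k}(G)+k$).
   Context: All graphs are finite, undirected and simple. For an integer $k\geq 1$ and a graph $G=(V,E)$ with minimum degree at least $k-1$, a Roman $k$-tuple dominating function (R$k$DF) on $G$ is a function $f\colon V\to\{0,1,2\}$ such that every vertex $v$ with $f(v)=0$ has at least $k$ neighbors $w$ with $f(w)=2$, and every vertex $v$ with $f(v)\neq 0$ has at least $k-1$ neighbors $w$ with $f(w)=2$. The weight of $f$ is $f(V)=\sum_{v\in V}f(v)$, and $\gamma_{\times kR}(G)$ is the minimum weight of an R$k$DF on $G$. A $k$-tuple dominating set of $G$ is a subset $S\subseteq V$ with $|N_G[v]\cap S|\geq k$ for every $v\in V$, where $N_G[v]$ is the closed neighborhood of $v$; the $k$-tuple domination number $\gamma_{\times k}(G)$ is the minimum cardinality of such a set. -}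

module Defs where

open import Data.Fin using (Fin; zero; suc; toℕ)
open import Data.Fin.Patterns using (0F; 2F)
open import Data.Fin.Properties using (any?; all?; _≟_)
open import Data.Fin.Subset using (Subset; inside; ⊤; ⁅_⁆; _∩_; _∪_; ∣_∣; _∈_)
open import Data.Fin.Subset.Properties
  using (anySubset?; p⊂q⇒∣p∣<∣q∣; q⊆p∪q; p⊆p∪q; x∈⁅x⁆; ∩-identityʳ)
open import Data.Nat using (ℕ; suc; _∸_; _≤_; _<_; NonZero; _≤?_; _<?_)
open import Data.Nat.Induction using (<-wellFounded)
open import Data.Nat.Properties using (≮⇒≥; ≤-trans; m≤n+m∸n; +-monoʳ-≤)
open import Data.Product using (∃; _×_; _,_; proj₁; proj₂)
open import Data.Unit using (tt)
open import Data.Vec using (Vec; []; _∷_; tabulate; lookup; sum)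
open import Data.Vec.Properties
  using (tabulate-cong; lookup∘tabulate; []=⇒lookup)
open import Function using (_∘_; const)
open import Induction.WellFounded using (Acc; acc)
open import Level using (0ℓ)
open import Relation.Binary using (Rel; Symmetric; Irreflexive)
import Relation.Binary as B
open import Relation.Binary.PropositionalEquality
  using (_≡_; _≢_; refl; sym; trans; cong; subst; _≗_)
open import Relation.Nullary
  using (Dec; does; yes; no; ¬?; map′; contradiction; _×-dec_; _→-dec_; _⊎-dec_)
open import Relation.Unary using (Pred; Decidable; U)

-- Vertices are Fin order. There is at least one vertex, since the minimum
-- degree of the null graph is undefined.
record Graph : Set₁ where
  field
    order       : ℕ
    {{nonEmpty}} : NonZero order
    Adj         : Rel (Fin order) 0ℓ
    Adj?        : B.Decidable Adj
    Adj-sym     : Symmetric Adj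
    Adj-irrefl  : Irreflexive _≡_ Adj

  Vertex : Set
  Vertex = Fin order

record Minimum {A : Set} (P : Pred A 0ℓ) (w : A → ℕ) : Set where
  field
    value    : ℕ
    minimal  : A
    holds    : P minimal
    attained : w minimal ≡ value
    lower    : ∀ a → P a → value ≤ w a

open Minimum

minimum : {A : Set} {P : Pred A 0ℓ} {w : A → ℕ} →
          (∀ m → Dec (∃ λ a → P a × w a < m)) → ∃ P → Minimum P w
minimum {A} {P} {w} below? (a , Pa) = go a Pa (<-wellFounded (w a))
  where
  go : ∀ a → P a → Acc _<_ (w a) → Minimum P w
  go a Pa (acc rec) with below? (w a)
  ... | yes (b , Pb , b<a) = go b Pb (rec b<a)
  ... | no none = record
    { value = w a ; minimal = a ; holds = Pa ; attained = refl
    ; lower = λ b Pb → ≮⇒≥ λ b<a → none (b , Pb , b<a) }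

private
  anyVec? : ∀ {m} n {P : Pred (Vec (Fin m) n) 0ℓ} → Decidable P → Dec (∃ P)
  anyVec? 0       P? = map′ ([] ,_) (λ { ([] , p) → p }) (P? [])
  anyVec? (suc n) P? = map′ (λ (x , xs , p) → x ∷ xs , p)
                            (λ { (x ∷ xs , p) → x , xs , p })
                            (any? λ x → anyVec? n (P? ∘ (x ∷_)))

  anyFunction? : ∀ {m n} {P : Pred (Fin n → Fin m) 0ℓ} → Decidable P →
                 (∀ {f g} → f ≗ g → P f → P g) → Dec (∃ P)
  anyFunction? {n = n} P? resp =
    map′ (λ (xs , p) → lookup xs , p)
         (λ (f , p) → tabulate f , resp (sym ∘ lookup∘tabulate f) p)
         (anyVec? n (P? ∘ lookup))

module _ (G : Graph) where
  open Graph G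

  N : Vertex → Subset order
  N v = tabulate λ w → does (Adj? v w)

  N[_] : Vertex → Subset order
  N[ v ] = ⁅ v ⁆ ∪ N v

  degree : Vertex → ℕ
  degree v = ∣ N v ∣

  private
    aVertex : ∀ n → .{{NonZero n}} → Fin n
    aVertex (suc n) = zero

  minDegree : Minimum U degree
  minDegree = minimum (λ m → any? λ v → yes tt ×-dec (degree v <? m))
                      (aVertex order , tt)

  δ : ℕ
  δ = value minDegree

  IsTupleDominating : ℕ → Pred (Subset order) 0ℓ
  IsTupleDominating k S = ∀ v → k ≤ ∣ N[ v ] ∩ S ∣

  Labelling : Set
  Labelling = Vertex → Fin 3

  weight : Labelling → ℕ
  weight f = sum (tabulate (toℕ ∘ f))

  V₂ : Labelling → Subset order
  V₂ f = tabulate λ w → does (f w ≟ 2F)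

  IsRomanTupleDominating : ℕ → Pred Labelling 0ℓ
  IsRomanTupleDominating k f =
    ∀ v → (f v ≡ 0F → k ≤ ∣ N v ∩ V₂ f ∣)
        × (f v ≢ 0F → k ∸ 1 ≤ ∣ N v ∩ V₂ f ∣)

  private
    isTuple? : ∀ k → Decidable (IsTupleDominating k)
    isTuple? k S = all? λ v → k ≤? ∣ N[ v ] ∩ S ∣

    isRoman? : ∀ k → Decidable (IsRomanTupleDominating k)
    isRoman? k f = all? λ v →
      ((f v ≟ 0F) →-dec (k ≤? ∣ N v ∩ V₂ f ∣)) ×-dec
      (¬? (f v ≟ 0F) →-dec (k ∸ 1 ≤? ∣ N v ∩ V₂ f ∣))

    weight-resp : ∀ {f g} → f ≗ g → weight f ≡ weight g
    weight-resp f≗g = cong sum (tabulate-cong (cong toℕ ∘ f≗g))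

    isRoman-resp : ∀ k {f g} → f ≗ g →
                   IsRomanTupleDominating k f → IsRomanTupleDominating k g
    isRoman-resp k {f} {g} f≗g h v =
        (λ gv≡0 → transport (proj₁ (h v) (trans (f≗g v) gv≡0)))
      , (λ gv≢0 → transport (proj₂ (h v) (gv≢0 ∘ trans (sym (f≗g v)))))
      where
      transport : ∀ {j} → j ≤ ∣ N v ∩ V₂ f ∣ → j ≤ ∣ N v ∩ V₂ g ∣
      transport {j} = subst (λ T → j ≤ ∣ N v ∩ T ∣)
        (tabulate-cong λ w → cong (λ x → does (x ≟ 2F)) (f≗g w))

    v∉N : ∀ v → v ∈ N v → Adj v v
    v∉N v v∈N with Adj? v v
                 | trans (sym (lookup∘tabulate (λ w → does (Adj? v w)) v))
                         ([]=⇒lookup v∈N)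
    ... | yes a | _ = a

    degree<∣N[]∣ : ∀ v → degree v < ∣ N[ v ] ∣
    degree<∣N[]∣ v = p⊂q⇒∣p∣<∣q∣
      ( q⊆p∪q ⁅ v ⁆ (N v) , v , p⊆p∪q {p = ⁅ v ⁆} (N v) (x∈⁅x⁆ v)
      , Adj-irrefl refl ∘ v∉N v )

    ⊤-isTuple : ∀ k → k ∸ 1 ≤ δ → IsTupleDominating k ⊤
    ⊤-isTuple k h v rewrite ∩-identityʳ N[ v ] =
      ≤-trans (m≤n+m∸n k 1)
        (≤-trans (+-monoʳ-≤ 1 (≤-trans h (lower minDegree v tt)))
                 (degree<∣N[]∣ v))

    const2-isRoman : ∀ k → k ∸ 1 ≤ δ → IsRomanTupleDominating k (const 2F)
    const2-isRoman k h v = (λ ()) , λ _ →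
      subst (λ T → k ∸ 1 ≤ ∣ T ∣)
        (sym (trans (cong (N v ∩_) (V₂-const order)) (∩-identityʳ (N v))))
        (≤-trans h (lower minDegree v tt))
      where
      V₂-const : ∀ n → tabulate {n = n} (const inside) ≡ ⊤
      V₂-const 0       = refl
      V₂-const (suc n) = cong (_ ∷_) (V₂-const n)

  minTuple : ∀ k → k ∸ 1 ≤ δ → Minimum (IsTupleDominating k) ∣_∣
  minTuple k h = minimum
    (λ m → anySubset? λ S → isTuple? k S ×-dec (∣ S ∣ <? m))
    (⊤ , ⊤-isTuple k h)

  minRoman : ∀ k → k ∸ 1 ≤ δ → Minimum (IsRomanTupleDominating k) weight
  minRoman k h = minimum
    (λ m → anyFunction? (λ f → isRoman? k f ×-dec (weight f <? m))
      λ f≗g (p , q) → isRoman-resp k f≗g p , subst (_< m) (weight-resp f≗g) q)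
    (const 2F , const2-isRoman k h)

  -- The bound on δ guarantees that a (Roman) k-tuple dominating set (function)
  -- exists, so that the minimum is defined. For k ≥ 1, k ∸ 1 is k - 1.
  γ× : ∀ k → k ∸ 1 ≤ δ → ℕ
  γ× k h = value (minTuple k h)

  γ×R : ∀ k → k ∸ 1 ≤ δ → ℕ
  γ×R k h = value (minRoman k h)

{-# OPTIONS --safe #-}

-- Lower bound: for a Roman function f, the set V₁ ∪ V₂ is k-tuple dominating
-- and w(f) = |V₁ ∪ V₂| + |V₂|, so it is enough that |V₂| ≥ k. A vertex labelled
-- 0 has k neighbours in V₂, and a vertex of V₂ has k - 1 neighbours in V₂
-- besides itself; a vertex labelled 1 has a neighbour in V₂, because k ≥ 2.
-- Upper bound: label a k-tuple dominating set with 2 and its complement with 0.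
-- Sharpness: in K_k we have γ× ≤ k, so γ× + k ≤ γ×R ≤ 2 γ× ≤ γ× + k.
module Submission where

open import Defs
open import Data.Bool using (if_then_else_; true; false)
open import Data.Fin using (Fin; suc; toℕ)
open import Data.Fin.Patterns using (0F; 1F; 2F)
open import Data.Fin.Properties using (_≟_)
open import Data.Fin.Subset
  using (Subset; inside; outside; ∁; ⁅_⁆; _∩_; _∪_; ∣_∣; _∈_; _∉_; _⊆_; Nonempty)
open import Data.Fin.Subset.Properties
  using ( x∈⁅x⁆; x∉⁅y⁆⇒x≢y; x∈⁅y⁆⇒x≡y; ∣⁅x⁆∣≡1
        ; ∣∁p∣≡n∸∣p∣; x∈∁p⇒x∉p; ∣p∣≤n; ∣p∩q∣≤∣q∣
        ; p⊆p∪q; q⊆p∪q; x∈p∪q⁻; x∈p∪q⁺; x∈p∩q⁺; x∈p∩q⁻; nonempty?; Empty-unique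
        ; ∣⊥∣≡0; p⊆q⇒∣p∣≤∣q∣; p⊂q⇒∣p∣<∣q∣ )
open import Data.Nat using (ℕ; zero; suc; _+_; _*_; _∸_; _≤_; _<_; z≤n; s≤s; s≤s⁻¹)
open import Data.Nat.Properties
  using ( ≤-trans; ≤-antisym; n≤1+n; +-suc; +-identityʳ; +-mono-≤
        ; +-monoʳ-≤; module ≤-Reasoning )
open import Data.Product using (_×_; Σ-syntax; _,_; proj₁; proj₂)
open import Data.Sum using (inj₁; inj₂)
open import Data.Vec using ([]; _∷_; tabulate; lookup; sum)
open import Data.Vec.Properties
  using (lookup∘tabulate; lookup⇒[]=; []=⇒lookup; tabulate-cong; tabulate∘lookup)
open import Function using (_∘_)
open import Level using (0ℓ)
open import Relation.Binary.PropositionalEquality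
  using (_≡_; _≢_; refl; sym; trans; cong; cong₂; subst)
open import Relation.Nullary using (does; yes; no; ¬?; contradiction)
open import Relation.Nullary.Decidable using (dec-true)
open import Relation.Unary using (Pred; Decidable)

open Minimum

-- `N G v` and `V₂ G f` unfold to sets of this form, so the two membership lemmas below serve for
-- both.
select : ∀ {n} {P : Pred (Fin n) 0ℓ} → Decidable P → Subset n
select P? = tabulate (does ∘ P?)

module _ {n} {P : Pred (Fin n) 0ℓ} (P? : Decidable P) where

  ∈-select⁺ : ∀ {x} → P x → x ∈ select P?
  ∈-select⁺ {x} Px = lookup⇒[]= x _
    (trans (lookup∘tabulate (does ∘ P?) x) (dec-true (P? x) Px))

  ∈-select⁻ : ∀ {x} → x ∈ select P? → P x
  ∈-select⁻ {x} x∈ with P? x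
                      | trans (sym (lookup∘tabulate (does ∘ P?) x)) ([]=⇒lookup x∈)
  ... | yes Px | _ = Px

∣p∪q∣≤∣p∣+∣q∣ : ∀ {n} (p q : Subset n) → ∣ p ∪ q ∣ ≤ ∣ p ∣ + ∣ q ∣
∣p∪q∣≤∣p∣+∣q∣ []            []            = z≤n
∣p∪q∣≤∣p∣+∣q∣ (outside ∷ p) (outside ∷ q) = ∣p∪q∣≤∣p∣+∣q∣ p q
∣p∪q∣≤∣p∣+∣q∣ (outside ∷ p) (inside  ∷ q) rewrite +-suc ∣ p ∣ ∣ q ∣ =
  s≤s (∣p∪q∣≤∣p∣+∣q∣ p q)
∣p∪q∣≤∣p∣+∣q∣ (inside  ∷ p) (outside ∷ q) = s≤s (∣p∪q∣≤∣p∣+∣q∣ p q)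
∣p∪q∣≤∣p∣+∣q∣ (inside  ∷ p) (inside  ∷ q) =
  s≤s (≤-trans (∣p∪q∣≤∣p∣+∣q∣ p q) (+-monoʳ-≤ ∣ p ∣ (n≤1+n ∣ q ∣)))

0<∣p∣⇒Nonempty : ∀ {n} (p : Subset n) → 0 < ∣ p ∣ → Nonempty p
0<∣p∣⇒Nonempty {n} p 0<∣p∣ with nonempty? p
... | yes ne = ne
... | no ¬ne =
  contradiction (subst (0 <_) (trans (cong ∣_∣ (Empty-unique ¬ne)) (∣⊥∣≡0 n)) 0<∣p∣) λ ()

-- A label 2 is counted in both sets, a label 1 only in the first, a label 0 in neither.
sum≡∣≢0∣+∣≡2∣ : ∀ {n} (f : Fin n → Fin 3) →
  sum (tabulate (toℕ ∘ f)) ≡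
  ∣ select (λ w → ¬? (f w ≟ 0F)) ∣ + ∣ select (λ w → f w ≟ 2F) ∣
sum≡∣≢0∣+∣≡2∣ {zero}  f = refl
sum≡∣≢0∣+∣≡2∣ {suc n} f with f 0F | sum≡∣≢0∣+∣≡2∣ (f ∘ suc)
... | 0F | ih = ih
... | 1F | ih = cong suc ih
... | 2F | ih = cong suc (trans (cong suc ih) (sym (+-suc _ _)))

module _ (G : Graph) where
  open Graph G

  -- Open and closed neighbourhoods

  v∉Nv : ∀ v → v ∉ N G v
  v∉Nv v = Adj-irrefl refl ∘ ∈-select⁻ (Adj? v)

  N∩⊆N[]∩ : ∀ v {S T} → S ⊆ T → N G v ∩ S ⊆ N[_] G v ∩ T
  N∩⊆N[]∩ v S⊆T x∈ with x∈p∩q⁻ (N G v) _ x∈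
  ... | x∈N , x∈S = x∈p∩q⁺ (q⊆p∪q ⁅ v ⁆ (N G v) x∈N , S⊆T x∈S)

  -- The vertex `v` itself makes the inclusion strict. This raises a bound of k - 1 on neighbours to
  -- k.
  ∣N∩∣<∣N[]∩∣ : ∀ {v S T} → S ⊆ T → v ∈ T → ∣ N G v ∩ S ∣ < ∣ N[_] G v ∩ T ∣
  ∣N∩∣<∣N[]∩∣ {v} {S} S⊆T v∈T = p⊂q⇒∣p∣<∣q∣
    ( N∩⊆N[]∩ v S⊆T , v , x∈p∩q⁺ (p⊆p∪q (N G v) (x∈⁅x⁆ v) , v∈T)
    , v∉Nv v ∘ proj₁ ∘ x∈p∩q⁻ (N G v) S )

  -- Passing to the open neighbourhood loses at most `v`, which is the slack allowed to vertices
  -- with a nonzero label.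
  ∣N[]∩∣≤1+∣N∩∣ : ∀ v S → ∣ N[_] G v ∩ S ∣ ≤ suc ∣ N G v ∩ S ∣
  ∣N[]∩∣≤1+∣N∩∣ v S = begin
    ∣ N[_] G v ∩ S ∣            ≤⟨ p⊆q⇒∣p∣≤∣q∣ split ⟩
    ∣ ⁅ v ⁆ ∪ (N G v ∩ S) ∣     ≤⟨ ∣p∪q∣≤∣p∣+∣q∣ ⁅ v ⁆ _ ⟩
    ∣ ⁅ v ⁆ ∣ + ∣ N G v ∩ S ∣   ≡⟨ cong (_+ ∣ N G v ∩ S ∣) (∣⁅x⁆∣≡1 v) ⟩
    suc ∣ N G v ∩ S ∣           ∎
    where
    open ≤-Reasoning
    split : N[_] G v ∩ S ⊆ ⁅ v ⁆ ∪ (N G v ∩ S)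
    split x∈ with x∈p∩q⁻ (N[_] G v) S x∈
    ... | x∈N[] , x∈S with x∈p∪q⁻ ⁅ v ⁆ (N G v) x∈N[]
    ... | inj₁ x∈v = x∈p∪q⁺ (inj₁ x∈v)
    ... | inj₂ x∈N = x∈p∪q⁺ (inj₂ (x∈p∩q⁺ (x∈N , x∈S)))

  v∉S⇒N[]∩⊆N∩ : ∀ {v S} → v ∉ S → N[_] G v ∩ S ⊆ N G v ∩ S
  v∉S⇒N[]∩⊆N∩ {v} {S} v∉S x∈ with x∈p∩q⁻ (N[_] G v) S x∈
  ... | x∈N[] , x∈S with x∈p∪q⁻ ⁅ v ⁆ (N G v) x∈N[]
  ... | inj₁ x∈v = contradiction (subst (_∈ S) (x∈⁅y⁆⇒x≡y v x∈v) x∈S) v∉S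
  ... | inj₂ x∈N = x∈p∩q⁺ (x∈N , x∈S)

  -- Lower bound

  support : Labelling G → Subset order
  support f = select λ w → ¬? (f w ≟ 0F)

  V₂⊆support : ∀ f → V₂ G f ⊆ support f
  V₂⊆support f x∈ = ∈-select⁺ (λ w → ¬? (f w ≟ 0F)) λ fx≡0 →
    contradiction (trans (sym fx≡0) (∈-select⁻ (λ w → f w ≟ 2F) x∈)) λ ()

  -- A vertex labelled 0 has enough neighbours in V₂ alone; any other vertex lies in the support and
  -- counts itself as well.
  support-dominating : ∀ {k f} → IsRomanTupleDominating G (suc k) f →
                       IsTupleDominating G (suc k) (support f)
  support-dominating {f = f} roman v with f v ≟ 0F
  ... | yes fv≡0 =
    ≤-trans (proj₁ (roman v) fv≡0) (p⊆q⇒∣p∣≤∣q∣ (N∩⊆N[]∩ v (V₂⊆support f)))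
  ... | no fv≢0 =
    ≤-trans (s≤s (proj₂ (roman v) fv≢0))
            (∣N∩∣<∣N[]∩∣ (V₂⊆support f) (∈-select⁺ (λ w → ¬? (f w ≟ 0F)) fv≢0))

  2+k≤∣V₂∣ : ∀ {k f} → IsRomanTupleDominating G (2 + k) f → Vertex →
           2 + k ≤ ∣ V₂ G f ∣
  2+k≤∣V₂∣ {k} {f} roman v with f v ≟ 0F
  ... | yes fv≡0 = ≤-trans (proj₁ (roman v) fv≡0) (∣p∩q∣≤∣q∣ (N G v) (V₂ G f))
  ... | no fv≢0
    -- Labels 1 and 2 are treated alike: `v` has at least `1 + k > 0` neighbours in V₂, and counting
    -- around one of them, `w`, includes `w` itself.
    with 0<∣p∣⇒Nonempty (N G v ∩ V₂ G f) (≤-trans (s≤s z≤n) (proj₂ (roman v) fv≢0))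
  ... | w , w∈ = begin
    2 + k                       ≤⟨ s≤s (proj₂ (roman w) fw≢0) ⟩
    suc ∣ N G w ∩ V₂ G f ∣      ≤⟨ ∣N∩∣<∣N[]∩∣ (λ x∈ → x∈) w∈V₂ ⟩
    ∣ N[_] G w ∩ V₂ G f ∣       ≤⟨ ∣p∩q∣≤∣q∣ (N[_] G w) (V₂ G f) ⟩
    ∣ V₂ G f ∣                  ∎
    where
    open ≤-Reasoning
    w∈V₂ : w ∈ V₂ G f
    w∈V₂ = proj₂ (x∈p∩q⁻ (N G v) (V₂ G f) w∈)
    fw≢0 : f w ≢ 0F
    fw≢0 = ∈-select⁻ (λ u → ¬? (f u ≟ 0F)) (V₂⊆support f w∈V₂)

  γ×+k≤γ×R : ∀ k (h : suc k ≤ δ G) → γ× G (2 + k) h + (2 + k) ≤ γ×R G (2 + k) h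
  γ×+k≤γ×R k h = begin
    γ× G (2 + k) h + (2 + k)       ≤⟨ +-mono-≤
      (lower (minTuple G (2 + k) h) _ (support-dominating (holds R)))
      -- Any vertex would do; one of minimum degree exists because the graph is nonempty.
      (2+k≤∣V₂∣ (holds R) (minimal (minDegree G))) ⟩
    ∣ support f ∣ + ∣ V₂ G f ∣     ≡⟨ sum≡∣≢0∣+∣≡2∣ f ⟨
    weight G f                     ≡⟨ attained R ⟩
    γ×R G (2 + k) h                ∎
    where
    open ≤-Reasoning
    R = minRoman G (2 + k) h
    f = minimal R

  -- Upper bound

  twice : Subset order → Labelling G
  twice S v = if lookup S v then 2F else 0F

  V₂-twice : ∀ S → V₂ G (twice S) ≡ S
  V₂-twice S = trans (tabulate-cong λ w → pointwise (lookup S w)) (tabulate∘lookup S)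
    where
    pointwise : ∀ b → does ((if b then 2F else 0F) ≟ 2F) ≡ b
    pointwise true  = refl
    pointwise false = refl

  support-twice : ∀ S → support (twice S) ≡ S
  support-twice S = trans (tabulate-cong λ w → pointwise (lookup S w)) (tabulate∘lookup S)
    where
    pointwise : ∀ b → does (¬? ((if b then 2F else 0F) ≟ 0F)) ≡ b
    pointwise true  = refl
    pointwise false = refl

  weight-twice : ∀ S → weight G (twice S) ≡ 2 * ∣ S ∣
  weight-twice S = trans (sum≡∣≢0∣+∣≡2∣ (twice S))
    (cong₂ _+_ (cong ∣_∣ (support-twice S))
               (trans (cong ∣_∣ (V₂-twice S)) (sym (+-identityʳ ∣ S ∣))))

  -- A vertex labelled 0 is outside `S`, so all the members of `S` that dominate it are neighbours;
  -- for a vertex labelled 2, at most one of them is the vertex itself.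
  twice-roman : ∀ {k S} → IsTupleDominating G (suc k) S →
                IsRomanTupleDominating G (suc k) (twice S)
  twice-roman {S = S} dom v rewrite V₂-twice S =
      (λ fv≡0 → ≤-trans (dom v) (p⊆q⇒∣p∣≤∣q∣ (v∉S⇒N[]∩⊆N∩ λ v∈S →
        contradiction (trans (sym fv≡0) (cong (if_then 2F else 0F) ([]=⇒lookup v∈S))) λ ())))
    , (λ _ → s≤s⁻¹ (≤-trans (dom v) (∣N[]∩∣≤1+∣N∩∣ v S)))

  γ×R≤2γ× : ∀ k (h : k ≤ δ G) → γ×R G (suc k) h ≤ 2 * γ× G (suc k) h
  γ×R≤2γ× k h = begin
    γ×R G (suc k) h               ≤⟨ lower (minRoman G (suc k) h) _ (twice-roman (holds D)) ⟩
    weight G (twice (minimal D))  ≡⟨ weight-twice (minimal D) ⟩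
    2 * ∣ minimal D ∣             ≡⟨ cong (2 *_) (attained D) ⟩
    2 * γ× G (suc k) h            ∎
    where
    open ≤-Reasoning
    D = minTuple G (suc k) h

-- Sharpness on complete graphs

complete : ℕ → Graph
complete n = record
  -- With `n + 1` vertices, every degree is `n`.
  { order      = suc n
  ; Adj        = _≢_
  ; Adj?       = λ v w → ¬? (v ≟ w)
  ; Adj-sym    = λ v≢w → v≢w ∘ sym
  ; Adj-irrefl = λ v≡w v≢w → v≢w v≡w
  }

-- The complement of a vertex has `n` elements, all adjacent to it.
n≤δ-complete : ∀ n → n ≤ δ (complete n)
n≤δ-complete n = begin
  n                       ≡⟨ cong (suc n ∸_) (∣⁅x⁆∣≡1 v) ⟨
  suc n ∸ ∣ ⁅ v ⁆ ∣       ≡⟨ ∣∁p∣≡n∸∣p∣ ⁅ v ⁆ ⟨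
  ∣ ∁ ⁅ v ⁆ ∣             ≤⟨ p⊆q⇒∣p∣≤∣q∣ (λ x∈ → ∈-select⁺ (λ w → ¬? (v ≟ w))
                               (x∉⁅y⁆⇒x≢y (x∈∁p⇒x∉p x∈) ∘ sym)) ⟩
  degree (complete n) v   ≡⟨ attained (minDegree (complete n)) ⟩
  δ (complete n)          ∎
  where
  open ≤-Reasoning
  v = minimal (minDegree (complete n))

γ×≤order : ∀ G k h → γ× G k h ≤ Graph.order G
γ×≤order G k h = subst (_≤ Graph.order G) (attained D) (∣p∣≤n (minimal D))
  where D = minTuple G k h

theorem2 : ∀ (k : ℕ) → 2 ≤ k →
    (∀ (G : Graph) (h : k ∸ 1 ≤ δ G) →
    (γ× G k h + k ≤ γ×R G k h) × (γ×R G k h ≤ 2 * γ× G k h))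
    × (Σ[ G ∈ Graph ] Σ[ h ∈ k ∸ 1 ≤ δ G ] γ×R G k h ≡ γ× G k h + k)
-- From here the parameter of the theorem is `2 + k`, so that `k ∸ 1` computes to `1 + k`.
theorem2 (suc (suc k)) (s≤s (s≤s z≤n)) =
    (λ G h → γ×+k≤γ×R G k h , γ×R≤2γ× G (suc k) h)
  , K , h , ≤-antisym upper (γ×+k≤γ×R K k h)
  where
  open ≤-Reasoning
  K = complete (suc k)
  h = n≤δ-complete (suc k)
  γ = γ× K (2 + k) h
  upper : γ×R K (2 + k) h ≤ γ + (2 + k)
  upper = begin
    γ×R K (2 + k) h   ≤⟨ γ×R≤2γ× K (suc k) h ⟩
    2 * γ             ≡⟨ cong (γ +_) (+-identityʳ γ) ⟩
    -- The order of `K` is exactly `2 + k`, so it bounds one of the two copies of `γ`.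
    γ + γ             ≤⟨ +-monoʳ-≤ γ (γ×≤order K (2 + k) h) ⟩
    γ + (2 + k)       ∎
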